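{- Let $p_1\in[0,1]$ and let $PG_n$ be the random pentagonal chain network described in the context. Then for every $n\geq 1$, $$\mathbb{E}\big(Gut(PG_{n})\big)=(72-24p_{1})n^{3}+(72p_{1}-12)n^{2}+(1-48p_{1})n-1.$$
   Context: Random chain network $PG_n$: $PG_1$ is a $5$-cycle (pentagon). For $n\ge 1$, $PG_{n+1}$ is obtained from $PG_n$ by adding a new pentagon $O_{n+1}$ with vertices $x_1,x_2,x_3,x_4,x_5$ in cyclic (clockwise) order and adding one edge joining $x_1$ to a vertex $u_n$ of $PG_n$. The vertex $u_1$ is any vertex of $PG_1$ (all are equivalent). For $n\ge 2$, $u_n$ is a vertex of the last pentagon $O_n$ (whose vertex $x_1$ is the one joined to $u_{n-1}$): with probability $p_1$ one takes $u_n\in\{x_2,x_5\}$ of $O_n$ (the two neighbours of $x_1$ in $O_n$), and with probability $p_2=1-p_1$ one takes $u_n\in\{x_3,x_4\}$ of $O_n$ (the two vertices at distance $2$ from $x_1$ in $O_n$); $p_1,p_2$ do not depend on the step. Thus $PG_n$ has $5n$ vertices. For a graph $G$, $d(v)$ denotes the degree of vertex $v$ and $d(u,v)$ the shortest-path distance. The Gutman index is $Gut(G)=\sum_{\{u,v\}\subseteq V_G} d(u)d(v)\,d(u,v)$, the sum over unordered pairs of distinct vertices. -}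

module Defs where

open import Algebra.Bundles using (CommutativeRing; Semiring)
open import Data.Fin using (Fin; toℕ; splitAt; _↑ˡ_; _<?_)
open import Data.Fin.Patterns using (0F; 1F; 2F; 3F; 4F)
import Data.Fin.Properties as Fin
open import Data.List using (List; []; _∷_; map; length; foldr; filter;
  takeWhile; upTo; allFin; cartesianProduct; cartesianProductWith)
open import Data.Nat using (ℕ; zero; suc; _+_; _*_)
open import Data.Nat.DivMod using (_%_)
open import Data.Nat.ListAction using (sum)
import Data.Nat.Properties as ℕ
open import Data.Product using (_×_; _,_; ∃)
open import Data.Sum using (_⊎_; inj₁; inj₂; swap)
open import Level using (0ℓ; _⊔_) renaming (suc to lsuc)
open import Relation.Binary using (Rel; Decidable; Symmetric; Irreflexive; IsPartialOrder)
open import Relation.Binary.PropositionalEquality using (_≡_; refl)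
open import Relation.Nullary using (Dec; ¬_; ¬?; _×-dec_; _⊎-dec_)

record Graph (N : ℕ) : Set₁ where
  field
    Adj    : Rel (Fin N) 0ℓ
    adj?   : Decidable Adj
    symm   : Symmetric Adj
    irrefl : Irreflexive _≡_ Adj

module _ {N : ℕ} (G : Graph N) where
  open Graph G

  degree : Fin N → ℕ
  degree v = length (filter (adj? v) (allFin N))

  Walk : ℕ → Fin N → Fin N → Set
  Walk zero    u v = u ≡ v
  Walk (suc k) u v = ∃ λ w → Adj u w × Walk k w v

  walk? : ∀ k u v → Dec (Walk k u v)
  walk? zero    u v = u Fin.≟ v
  walk? (suc k) u v = Fin.any? (λ w → adj? u w ×-dec walk? k w v)

  -- The least length of a walk from u to v: the number of k before the first
  -- one for which a walk of length k exists.  Searching k < N is enough, since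
  -- a shortest walk repeats no vertex; the value is N if v is not reachable.
  dist : Fin N → Fin N → ℕ
  dist u v = length (takeWhile (λ k → ¬? (walk? k u v)) (upTo N))

  -- Each unordered pair of distinct vertices is listed once, as (u , v) with u < v.
  vertexPairs : List (Fin N × Fin N)
  vertexPairs = filter (λ (u , v) → u <? v) (cartesianProduct (allFin N) (allFin N))

  Gut : ℕ
  Gut = sum (map (λ (u , v) → degree u * degree v * dist u v) vertexPairs)

-- The vertices x₁, …, x₅ of a pentagon, in cyclic order, are 0F, …, 4F.
pentagon : Graph 5
pentagon = record
  { Adj    = λ i j → Next i j ⊎ Next j i
  ; adj?   = λ i j → next? i j ⊎-dec next? j i
  ; symm   = swap
  ; irrefl = λ { {i} refl → λ { (inj₁ p) → next-irrefl i p ; (inj₂ p) → next-irrefl i p } }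
  }
  where

  Next : Rel (Fin 5) 0ℓ
  Next i j = toℕ j ≡ suc (toℕ i) % 5

  next? : Decidable Next
  next? i j = toℕ j ℕ.≟ suc (toℕ i) % 5

  next-irrefl : ∀ i → ¬ Next i i
  next-irrefl 0F ()
  next-irrefl 1F ()
  next-irrefl 2F ()
  next-irrefl 3F ()
  next-irrefl 4F ()

-- A new pentagon, whose vertices are numbered before those of G, together with
-- one edge from its vertex x₁ to the vertex a of G.
attach : ∀ {N} → Graph N → Fin N → Graph (5 + N)
attach {N} G a = record
  { Adj    = λ i j → E (splitAt 5 i) (splitAt 5 j)
  ; adj?   = λ i j → E? (splitAt 5 i) (splitAt 5 j)
  ; symm   = λ {i} {j} → E-sym (splitAt 5 i) (splitAt 5 j)
  ; irrefl = λ { {i} refl → E-irrefl (splitAt 5 i) }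
  }
  where
  module P = Graph pentagon
  module G = Graph G

  E : Rel (Fin 5 ⊎ Fin N) 0ℓ
  E (inj₁ i) (inj₁ j) = P.Adj i j
  E (inj₁ i) (inj₂ w) = i ≡ 0F × w ≡ a
  E (inj₂ v) (inj₁ j) = j ≡ 0F × v ≡ a
  E (inj₂ v) (inj₂ w) = G.Adj v w

  E? : Decidable E
  E? (inj₁ i) (inj₁ j) = P.adj? i j
  E? (inj₁ i) (inj₂ w) = i Fin.≟ 0F ×-dec w Fin.≟ a
  E? (inj₂ v) (inj₁ j) = j Fin.≟ 0F ×-dec v Fin.≟ a
  E? (inj₂ v) (inj₂ w) = G.adj? v w

  E-sym : ∀ s t → E s t → E t s
  E-sym (inj₁ i) (inj₁ j) = P.symm
  E-sym (inj₁ _) (inj₂ _) e = e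
  E-sym (inj₂ _) (inj₁ _) e = e
  E-sym (inj₂ v) (inj₂ w) = G.symm

  E-irrefl : ∀ s → ¬ E s s
  E-irrefl (inj₁ _) = P.irrefl refl
  E-irrefl (inj₂ _) = G.irrefl refl

data Choice : Set where
  x₂ x₃ x₄ x₅ : Choice

choices : List Choice
choices = x₂ ∷ x₃ ∷ x₄ ∷ x₅ ∷ []

vertex : Choice → Fin 5
vertex x₂ = 1F
vertex x₃ = 2F
vertex x₄ = 3F
vertex x₅ = 4F

-- The outcomes (u₂ , … , uₙ₋₁) of the random choices that produce a chain of
-- n pentagons.  Neither the first pentagon nor the second involves a choice.
data History : ℕ → Set where
  one  : History 1
  two  : History 2
  grow : ∀ {k} → History (2 + k) → Choice → History (3 + k)

histories : ∀ n → List (History n)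
histories 0                     = []
histories 1                     = one ∷ []
histories 2                     = two ∷ []
histories (suc n@(suc (suc _))) = cartesianProductWith grow (histories n) choices

-- The chain produced by a history, for a given choice of u₁.
PG : Fin 5 → ∀ {n} → History n → Graph (n * 5)
PG u₁ one            = pentagon
PG u₁ two            = attach pentagon u₁
PG u₁ (grow {k} h c) = attach (PG u₁ h) (vertex c ↑ˡ (1 + k) * 5)

-- Commutative rings with a compatible partial order; the real numbers are one.
record OrderedCommutativeRing c ℓ₁ ℓ₂ : Set (lsuc (c ⊔ ℓ₁ ⊔ ℓ₂)) where
  field
    commutativeRing : CommutativeRing c ℓ₁
  open CommutativeRing commutativeRing public
    renaming (_+_ to infixl 6 _+ᴿ_; _*_ to infixl 7 _*ᴿ_; _-_ to infixl 6 _-ᴿ_)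
  infix 4 _≤_
  field
    _≤_            : Rel Carrier ℓ₂
    isPartialOrder : IsPartialOrder _≈_ _≤_
    +-monoˡ-≤      : ∀ {x y} z → x ≤ y → x +ᴿ z ≤ y +ᴿ z
    *-nonneg       : ∀ {x y} → 0# ≤ x → 0# ≤ y → 0# ≤ x *ᴿ y

  open import Algebra.Definitions.RawSemiring (Semiring.rawSemiring semiring)
    using () renaming (_×_ to _times_; _^_ to infixr 8 _^ᴿ_) public

  ι : ℕ → Carrier
  ι n = n times 1#

module _ {c ℓ₁ ℓ₂} (R : OrderedCommutativeRing c ℓ₁ ℓ₂) where
  open OrderedCommutativeRing R

  -- weight h c is the conditional probability that the next attaching vertex is
  -- c, given the earlier choices h.  Only the probabilities p₁ of {x₂, x₅} and
  -- p₂ of {x₃, x₄} are prescribed: how each splits between its two vertices is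
  -- arbitrary, and may depend on h (a fixed selection rule is a 0/1 split).
  record Law (p₁ p₂ : Carrier) : Set (c ⊔ ℓ₁ ⊔ ℓ₂) where
    field
      weight    : ∀ {k} → History (2 + k) → Choice → Carrier
      nonneg    : ∀ {k} (h : History (2 + k)) x → 0# ≤ weight h x
      weight-p₁ : ∀ {k} (h : History (2 + k)) → weight h x₂ +ᴿ weight h x₅ ≈ p₁
      weight-p₂ : ∀ {k} (h : History (2 + k)) → weight h x₃ +ᴿ weight h x₄ ≈ p₂

  module _ {p₁ p₂ : Carrier} (law : Law p₁ p₂) where
    open Law law

    prob : ∀ {n} → History n → Carrier
    prob one        = 1#
    prob two        = 1#
    prob (grow h x) = prob h *ᴿ weight h x

    𝔼 : ∀ {n} → (History n → Carrier) → Carrier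
    𝔼 {n} X = foldr (λ h s → prob h *ᴿ X h +ᴿ s) 0# (histories n)

{-# OPTIONS --safe #-}
-- Attach a pentagon to a vertex a of a connected graph G with n pentagons, and
-- let T(G, a) = Σᵥ d(v) d(a, v).  The degree of a grows by 1, which adds T(G, a)
-- to the pairs inside G; every path between G and the new pentagon uses the new
-- edge, so the remaining pairs contribute 11 T(G, a) plus a term in n.  Also,
-- T(attach G a, x) = T(G, a) plus a term in n and in the distance (1 or 2) of x
-- from x₁.  The increments of Gut and T hence depend on the next choice only
-- through its distance from x₁, so both expectations satisfy linear recursions.
-- They are solved in the form p₁ f(n) + p₂ g(n) with f, g natural-valued.

module Submission where

open import Defs
import Data.Nat.Properties
open import Algebra.Properties.Semiring.Sum Data.Nat.Properties.+-*-semiring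
  using (sum; ∑-distrib-+; sum-cong-≗; sum-replicate-zero; *-distribˡ-sum)
open import Data.Bool using (Bool; true; false; if_then_else_)
open import Data.Fin using (Fin; zero; suc; toℕ; splitAt; join; _↑ˡ_; _↑ʳ_; _<?_)
open import Data.Fin.Patterns using (0F; 1F; 2F; 3F; 4F)
open import Data.Fin.Properties using (_≟_; all?; splitAt-↑ˡ; join-splitAt)
open import Data.List using (List; []; _∷_; _++_; map; length; foldr; filter; takeWhile;
  applyUpTo; tabulate; allFin; cartesianProduct; cartesianProductWith)
open import Data.List.Properties using (map-++; map-tabulate)
open import Data.Nat using (ℕ; zero; suc; _+_; _*_; _∸_; _⊓_; ∣_-_∣; _<_; z≤n; s≤s) renaming (_≤_ to _≤ℕ_)
import Data.Nat as ℕ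
import Data.Nat.ListAction as List
import Data.Nat.ListAction.Properties as List
open import Data.Nat.Properties using (≤-refl; ≤-trans; ≤-reflexive; <-≤-trans; <⇒≱; m≤m+n;
  m≤n+m; n≤1+n; +-mono-≤; +-monoˡ-≤; +-monoʳ-≤; +-comm; +-assoc; +-suc; +-identityʳ; *-assoc;
  *-zeroʳ; *-distribʳ-+)
open import Data.Nat.Tactic.RingSolver using (solve-∀)
open import Data.Product using (_×_; _,_)
open import Data.Sum using (_⊎_; inj₁; inj₂)
open import Function using (_∘_; id)
open import Level using (Level; 0ℓ)
open import Relation.Binary.PropositionalEquality
  using (_≡_; refl; sym; trans; cong; cong₂; subst; subst₂; module ≡-Reasoning)
open import Relation.Nullary using (yes; no; does; ¬_; ¬?)
open import Relation.Nullary.Decidable using (from-yes; _→-dec_; dec-true; dec-false)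
open import Relation.Unary using (Pred; Decidable)

private variable
  ℓ : Level
  A B : Set ℓ
  N : ℕ

-- Finite sums

⟦_⟧ : Bool → ℕ
⟦ b ⟧ = if b then 1 else 0

-- Used to turn `degree`, the length of a filtered list, into a sum of indicators, which computes on
-- the vertices of a new pentagon.
length-filter : ∀ {P : Pred A 0ℓ} (P? : Decidable P) (f : Fin N → A) →
  length (filter P? (tabulate f)) ≡ sum (λ i → ⟦ does (P? (f i)) ⟧)
length-filter {N = zero}  P? f = refl
length-filter {N = suc N} P? f with does (P? (f zero))
... | true  = cong suc (length-filter P? (f ∘ suc))
... | false = length-filter P? (f ∘ suc)

sum-filter : ∀ {P : Pred A 0ℓ} (P? : Decidable P) (f : A → ℕ) xs →
  List.sum (map f (filter P? xs)) ≡ List.sum (map (λ x → ⟦ does (P? x) ⟧ * f x) xs)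
sum-filter P? f []       = refl
sum-filter P? f (x ∷ xs) with does (P? x)
... | true  = cong₂ _+_ (sym (+-identityʳ (f x))) (sum-filter P? f xs)
... | false = sum-filter P? f xs

sum-tabulate : (f : Fin N → ℕ) → List.sum (tabulate f) ≡ sum f
sum-tabulate {zero}  f = refl
sum-tabulate {suc N} f = cong (f zero +_) (sum-tabulate (f ∘ suc))

sum-cartesianProduct : ∀ {M} (f : A × B → ℕ) (g : Fin M → A) (h : Fin N → B) →
  List.sum (map f (cartesianProduct (tabulate g) (tabulate h))) ≡ sum (λ i → sum (λ j → f (g i , h j)))
sum-cartesianProduct {M = zero}  f g h = refl
sum-cartesianProduct {M = suc M} f g h = begin
  List.sum (map f (row ++ rest))
    ≡⟨ cong List.sum (map-++ f row rest) ⟩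
  List.sum (map f row ++ map f rest)
    ≡⟨ List.sum-++ (map f row) (map f rest) ⟩
  List.sum (map f row) + List.sum (map f rest)
    ≡⟨ cong₂ _+_ (trans (cong List.sum (trans (cong (map f) (map-tabulate h (g zero ,_))) (map-tabulate (λ j → g zero , h j) f))) (sum-tabulate (λ j → f (g zero , h j)))) (sum-cartesianProduct f (g ∘ suc) h) ⟩
  sum (λ i → sum (λ j → f (g i , h j))) ∎
  where
  open ≡-Reasoning
  row  = map (g zero ,_) (tabulate h)
  rest = cartesianProduct (tabulate (g ∘ suc)) (tabulate h)

sum-zero : sum {N} (λ _ → 0) ≡ 0
sum-zero {N} = sum-replicate-zero N

sum-indicator : (a : Fin N) (f : Fin N → ℕ) → sum (λ v → ⟦ does (v ≟ a) ⟧ * f v) ≡ f a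
sum-indicator {suc N} zero    f = trans (cong₂ _+_ (+-identityʳ (f zero)) (sum-zero {N})) (+-identityʳ (f zero))
sum-indicator {suc N} (suc a) f = sum-indicator a (f ∘ suc)

sum-indicator₁ : (a : Fin N) → sum (λ v → ⟦ does (v ≟ a) ⟧) ≡ 1
sum-indicator₁ {suc N} zero    = cong suc (sum-zero {N})
sum-indicator₁ {suc N} (suc a) = sum-indicator₁ a

-- Recursion on the first vertex needs no test `u <? v`, and on `5 + N` it unfolds by computation
-- into five rows and the pairs of the old graph.
pairSum : ∀ N → (Fin N → Fin N → ℕ) → ℕ
pairSum zero    f = 0
pairSum (suc N) f = sum (λ v → f zero (suc v)) + pairSum N (λ u v → f (suc u) (suc v))

pairSum-cong : {f g : Fin N → Fin N → ℕ} → (∀ u v → f u v ≡ g u v) → pairSum N f ≡ pairSum N g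
pairSum-cong {zero}  eq = refl
pairSum-cong {suc N} eq = cong₂ _+_ (sum-cong-≗ (λ v → eq zero (suc v))) (pairSum-cong (λ u v → eq (suc u) (suc v)))

pairSum-+ : (f g : Fin N → Fin N → ℕ) → pairSum N (λ u v → f u v + g u v) ≡ pairSum N f + pairSum N g
pairSum-+ {zero}  f g = refl
pairSum-+ {suc N} f g = trans
  (cong₂ _+_ (∑-distrib-+ (λ v → f zero (suc v)) (λ v → g zero (suc v))) (pairSum-+ (λ u v → f (suc u) (suc v)) (λ u v → g (suc u) (suc v))))
  (interchange (sum (λ v → f zero (suc v))) _ _ _)
  where
  interchange : ∀ a b c d → (a + b) + (c + d) ≡ (a + c) + (b + d)
  interchange = solve-∀

-- The off-diagonal products are grouped by unordered pair. With an indicator for `f`, this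
-- evaluates a sum over the pairs that contain a given vertex.
sum-*-sum : (f g : Fin N → ℕ) →
  sum f * sum g ≡ pairSum N (λ u v → f u * g v + g u * f v) + sum (λ v → f v * g v)
sum-*-sum {zero}  f g = refl
sum-*-sum {suc N} f g = begin
  (f₀ + F) * (g₀ + G)
    ≡⟨ expand f₀ F g₀ G ⟩
  (f₀ * G + g₀ * F) + F * G + f₀ * g₀
    ≡⟨ cong₂ (λ x y → x + y + f₀ * g₀) (sym row) (sum-*-sum (f ∘ suc) (g ∘ suc)) ⟩
  sum (λ v → f₀ * g (suc v) + g₀ * f (suc v)) + (P + Q) + f₀ * g₀
    ≡⟨ reassoc (sum (λ v → f₀ * g (suc v) + g₀ * f (suc v))) P Q (f₀ * g₀) ⟩
  sum (λ v → f₀ * g (suc v) + g₀ * f (suc v)) + P + (f₀ * g₀ + Q) ∎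
  where
  open ≡-Reasoning
  f₀ = f zero
  g₀ = g zero
  F = sum (f ∘ suc)
  G = sum (g ∘ suc)
  P = pairSum N (λ u v → f (suc u) * g (suc v) + g (suc u) * f (suc v))
  Q = sum (λ v → f (suc v) * g (suc v))
  row : sum (λ v → f₀ * g (suc v) + g₀ * f (suc v)) ≡ f₀ * G + g₀ * F
  row = trans (∑-distrib-+ (λ v → f₀ * g (suc v)) (λ v → g₀ * f (suc v)))
    (sym (cong₂ _+_ (*-distribˡ-sum f₀ (g ∘ suc)) (*-distribˡ-sum g₀ (f ∘ suc))))
  expand : ∀ a b c d → (a + b) * (c + d) ≡ (a * d + c * b) + b * d + a * c
  expand = solve-∀
  reassoc : ∀ a b c d → a + (b + c) + d ≡ a + b + (d + c)
  reassoc = solve-∀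

-- The tests compute: entries with second vertex `zero` vanish, and `suc u <? suc v` decides as
-- `u <? v` does.
sum-<-pairs : (f : Fin N → Fin N → ℕ) → sum (λ u → sum (λ v → ⟦ does (u <? v) ⟧ * f u v)) ≡ pairSum N f
sum-<-pairs {zero}  f = refl
sum-<-pairs {suc N} f = cong₂ _+_
  (sum-cong-≗ (λ v → +-identityʳ (f zero (suc v))))
  (sum-<-pairs (λ u v → f (suc u) (suc v)))

Gut-pairSum : (G : Graph N) → Gut G ≡ pairSum N (λ u v → degree G u * degree G v * dist G u v)
Gut-pairSum {N} G = begin
  Gut G
    ≡⟨ sum-filter (λ (u , v) → u <? v) f (cartesianProduct (allFin N) (allFin N)) ⟩
  List.sum (map (λ (u , v) → ⟦ does (u <? v) ⟧ * f (u , v)) (cartesianProduct (allFin N) (allFin N)))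
    ≡⟨ sum-cartesianProduct (λ (u , v) → ⟦ does (u <? v) ⟧ * f (u , v)) id id ⟩
  sum (λ u → sum (λ v → ⟦ does (u <? v) ⟧ * f (u , v)))
    ≡⟨ sum-<-pairs (λ u v → f (u , v)) ⟩
  pairSum N (λ u v → f (u , v)) ∎
  where
  open ≡-Reasoning
  f : Fin N × Fin N → ℕ
  f (u , v) = degree G u * degree G v * dist G u v

-- Distances

-- A certificate for the graph distance: `walk` shows that the value is attained, `lipschitz` and
-- `diagonal` that no walk is shorter, and `bounded` that the search in `dist` reaches it.
record IsDistance (G : Graph N) (d : Fin N → Fin N → ℕ) : Set where
  open Graph G
  field
    bounded   : ∀ u v → d u v < N
    walk      : ∀ u v → Walk G (d u v) u v
    lipschitz : ∀ {u w} → Adj u w → ∀ v → d u v ≤ℕ suc (d w v)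
    diagonal  : ∀ v → d v v ≡ 0
    symmetric : ∀ u v → d u v ≡ d v u

  minimal : ∀ {k u v} → Walk G k u v → d u v ≤ℕ k
  minimal {zero}  {u} refl      = ≤-reflexive (diagonal u)
  minimal {suc k} {v = v} (w , e , p) = ≤-trans (lipschitz e v) (s≤s (minimal p))

length-takeWhile : ∀ {P : Pred A 0ℓ} (P? : Decidable P) (f : ℕ → A) {n d} → d < n →
  (∀ {k} → k < d → P (f k)) → ¬ P (f d) → length (takeWhile P? (applyUpTo f n)) ≡ d
length-takeWhile P? f {suc n} {zero}  d<n below at rewrite dec-false (P? (f 0)) at = refl
length-takeWhile P? f {suc n} {suc d} (s≤s d<n) below at rewrite dec-true (P? (f 0)) (below (s≤s z≤n)) =
  cong suc (length-takeWhile P? (f ∘ suc) d<n (below ∘ s≤s) at)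

dist-unique : {G : Graph N} {d : Fin N → Fin N → ℕ} → IsDistance G d → ∀ u v → dist G u v ≡ d u v
dist-unique {G = G} D u v = length-takeWhile (λ k → ¬? (walk? G k u v)) id (bounded u v)
  (λ k<d p → <⇒≱ k<d (minimal p)) (λ ¬p → ¬p (walk u v))
  where open IsDistance D

-- An unreachable vertex has `dist` equal to `N`, which violates `bounded`.
Connected : Graph N → Set
Connected G = IsDistance G (dist G)

connected : {G : Graph N} {d : Fin N → Fin N → ℕ} → IsDistance G d → Connected G
connected {N} {G} {d} D = record
  { bounded   = λ u v → subst (_< N) (sym (eq u v)) (bounded u v)
  ; walk      = λ u v → subst (λ k → Walk G k u v) (sym (eq u v)) (walk u v)
  ; lipschitz = λ {u} {w} e v → subst₂ (λ k l → k ≤ℕ suc l) (sym (eq u v)) (sym (eq w v)) (lipschitz e v)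
  ; diagonal  = λ v → trans (eq v v) (diagonal v)
  ; symmetric = λ u v → trans (eq u v) (trans (symmetric u v) (sym (eq v u)))
  }
  where
  open IsDistance D
  eq = dist-unique D

-- The shorter of the two arcs of the 5-cycle.
cycleDist : Fin 5 → Fin 5 → ℕ
cycleDist i j = k ⊓ (5 ∸ k)
  where k = ∣ toℕ i - toℕ j ∣

cycleDist≤2 : ∀ i j → cycleDist i j ≤ℕ 2
cycleDist≤2 = from-yes (all? λ i → all? λ j → cycleDist i j ℕ.≤? 2)

pentagon-distance : IsDistance pentagon cycleDist
pentagon-distance = record
  { bounded   = λ i j → ≤-trans (s≤s (cycleDist≤2 i j)) (s≤s (s≤s (s≤s z≤n)))
  ; walk      = from-yes (all? λ i → all? λ j → walk? pentagon (cycleDist i j) i j)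
  ; lipschitz = λ {i} {k} → from-yes (all? λ i → all? λ k → P.adj? i k →-dec (all? λ j → cycleDist i j ℕ.≤? suc (cycleDist k j))) i k
  ; diagonal  = from-yes (all? λ i → cycleDist i i ℕ.≟ 0)
  ; symmetric = from-yes (all? λ i → all? λ j → cycleDist i j ℕ.≟ cycleDist j i)
  }
  where module P = Graph pentagon

walk-map : ∀ {M} {G : Graph M} {H : Graph N} (φ : Fin M → Fin N) →
  (∀ {u v} → Graph.Adj G u v → Graph.Adj H (φ u) (φ v)) →
  ∀ k {u v} → Walk G k u v → Walk H k (φ u) (φ v)
walk-map φ hom zero    refl        = refl
walk-map {G = G} {H} φ hom (suc k) (w , e , p) = φ w , hom e , walk-map {G = G} {H} φ hom k p

walk-++ : {G : Graph N} → ∀ k {l u v w} → Walk G k u v → Walk G l v w → Walk G (k + l) u w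
walk-++ zero    refl        q = q
walk-++ {G = G} (suc k) (x , e , p) q = x , e , walk-++ {G = G} k p q

-- Attaching a pentagon

module _ (G : Graph N) (a : Fin N) (G-connected : Connected G) where
  private
    module G = IsDistance G-connected
    module H = Graph (attach G a)
    module P = Graph pentagon
    module C = IsDistance pentagon-distance
    V = Fin 5 ⊎ Fin N

  -- The new edge is a bridge: it shortens no path inside either part, and every path between the
  -- parts passes through `0F` and `a`.
  attachDist : V → V → ℕ
  attachDist (inj₁ i) (inj₁ j) = cycleDist i j
  attachDist (inj₁ i) (inj₂ w) = cycleDist i 0F + suc (dist G a w)
  attachDist (inj₂ v) (inj₁ j) = cycleDist j 0F + suc (dist G a v)
  attachDist (inj₂ v) (inj₂ w) = dist G v w

  private
    new-edge : ∀ {i j} → P.Adj i j → H.Adj (i ↑ˡ N) (j ↑ˡ N)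
    new-edge {i} {j} e rewrite splitAt-↑ˡ 5 i N | splitAt-↑ˡ 5 j N = e

    new-walk : ∀ i j → Walk (attach G a) (cycleDist i j) (i ↑ˡ N) (j ↑ˡ N)
    new-walk i j = walk-map {G = pentagon} {attach G a} (_↑ˡ N) new-edge _ (C.walk i j)

    old-walk : ∀ v w → Walk (attach G a) (dist G v w) (5 ↑ʳ v) (5 ↑ʳ w)
    old-walk v w = walk-map {G = G} {attach G a} (5 ↑ʳ_) id _ (G.walk v w)

    joined-walk : ∀ s t → Walk (attach G a) (attachDist s t) (join 5 N s) (join 5 N t)
    joined-walk (inj₁ i) (inj₁ j) = new-walk i j
    joined-walk (inj₁ i) (inj₂ w) = walk-++ {G = attach G a} (cycleDist i 0F)
      (new-walk i 0F) (5 ↑ʳ a , (refl , refl) , old-walk a w)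
    -- This walk starts in `G`, so its length has the summands of `attachDist` in the opposite
    -- order.
    joined-walk (inj₂ v) (inj₁ j) = subst (λ k → Walk (attach G a) k (5 ↑ʳ v) (j ↑ˡ N))
      (trans (+-suc (dist G v a) _) (trans (+-comm (suc (dist G v a)) _)
        (cong₂ (λ x y → x + suc y) (C.symmetric 0F j) (G.symmetric v a))))
      (walk-++ {G = attach G a} (dist G v a) (old-walk v a) (0F , (refl , refl) , new-walk 0F j))
    joined-walk (inj₂ v) (inj₂ w) = old-walk v w

    crossing-bounded : ∀ i v → cycleDist i 0F + suc (dist G a v) < 5 + N
    crossing-bounded i v = s≤s (≤-trans (+-mono-≤ (cycleDist≤2 i 0F) (G.bounded a v)) (+-monoˡ-≤ N (s≤s (s≤s z≤n))))

  attach-distance : IsDistance (attach G a) (λ u v → attachDist (splitAt 5 u) (splitAt 5 v))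
  attach-distance = record
    { bounded   = λ u v → bnd (splitAt 5 u) (splitAt 5 v)
    ; walk      = λ u v → subst₂ (Walk (attach G a) (attachDist (splitAt 5 u) (splitAt 5 v)))
                    (join-splitAt 5 N u) (join-splitAt 5 N v) (joined-walk (splitAt 5 u) (splitAt 5 v))
    ; lipschitz = λ {u} {w} → lip u w
    ; diagonal  = λ v → diag (splitAt 5 v)
    ; symmetric = λ u v → symm (splitAt 5 u) (splitAt 5 v)
    }
    where
    bnd : ∀ s t → attachDist s t < 5 + N
    bnd (inj₁ i) (inj₁ j) = ≤-trans (s≤s (cycleDist≤2 i j)) (s≤s (s≤s (s≤s z≤n)))
    bnd (inj₁ i) (inj₂ w) = crossing-bounded i w
    bnd (inj₂ v) (inj₁ j) = crossing-bounded j v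
    bnd (inj₂ v) (inj₂ w) = <-≤-trans (G.bounded v w) (m≤n+m N 5)

    diag : ∀ s → attachDist s s ≡ 0
    diag (inj₁ i) = C.diagonal i
    diag (inj₂ v) = G.diagonal v

    symm : ∀ s t → attachDist s t ≡ attachDist t s
    symm (inj₁ i) (inj₁ j) = C.symmetric i j
    symm (inj₁ i) (inj₂ w) = refl
    symm (inj₂ v) (inj₁ j) = refl
    symm (inj₂ v) (inj₂ w) = G.symmetric v w

    lip : ∀ u w → H.Adj u w → ∀ v →
      attachDist (splitAt 5 u) (splitAt 5 v) ≤ℕ suc (attachDist (splitAt 5 w) (splitAt 5 v))
    -- Cases on the edge, then on the target. An edge inside one part inherits the bound of that
    -- part; matching on `(refl , refl)` identifies the ends of the bridge.
    lip u w e v with splitAt 5 u | splitAt 5 w | splitAt 5 v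
    ... | inj₁ i | inj₁ j | inj₁ k = C.lipschitz e k
    ... | inj₁ i | inj₁ j | inj₂ x = +-monoˡ-≤ (suc (dist G a x)) (C.lipschitz e 0F)
    lip u w (refl , refl) v | inj₁ _ | inj₂ _ | inj₁ k =
      ≤-trans (≤-reflexive (C.symmetric 0F k)) (≤-trans (m≤m+n _ _) (n≤1+n _))
    lip u w (refl , refl) v | inj₁ _ | inj₂ _ | inj₂ x = ≤-refl
    lip u w (refl , refl) v | inj₂ _ | inj₁ _ | inj₁ k = ≤-reflexive (trans (+-suc _ _)
      (cong suc (trans (cong₂ _+_ (C.symmetric k 0F) (G.diagonal a)) (+-identityʳ _))))
    lip u w (refl , refl) v | inj₂ _ | inj₁ _ | inj₂ x = m≤n+m _ 2
    -- Here the distance to the new pentagon is measured from `a`, so the bound in `G` towards the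
    -- target `a` is used after a swap of arguments.
    ... | inj₂ x | inj₂ y | inj₁ k = ≤-trans
      (+-monoʳ-≤ (cycleDist k 0F) (s≤s (subst₂ (λ m n → m ≤ℕ suc n) (G.symmetric x a) (G.symmetric y a) (G.lipschitz e a))))
      (≤-reflexive (+-suc (cycleDist k 0F) _))
    ... | inj₂ x | inj₂ y | inj₂ z = G.lipschitz e z

-- Degrees, transmissions and the Gutman index after attaching

totalDegree : Graph N → ℕ
totalDegree G = sum (degree G)

transmission : Graph N → Fin N → ℕ
transmission G a = sum (λ v → degree G v * dist G a v)

module _ (G : Graph N) (a : Fin N) (G-connected : Connected G) where
  private
    module G = IsDistance G-connected

    δ : Fin N → ℕ
    δ v = ⟦ does (v ≟ a) ⟧

    deg : Fin N → ℕ
    deg v = δ v + degree G v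

    S T : ℕ
    S = totalDegree G
    T = transmission G a

    attachDegree : Fin 5 ⊎ Fin N → ℕ
    attachDegree (inj₁ zero)    = 3
    attachDegree (inj₁ (suc _)) = 2
    attachDegree (inj₂ v)       = deg v

    degree-attach : ∀ u → degree (attach G a) u ≡ attachDegree (splitAt 5 u)
    degree-attach u = trans (length-filter (Graph.adj? (attach G a) u) id) (count u)
      where
      count : ∀ u → sum (λ w → ⟦ does (Graph.adj? (attach G a) u w) ⟧) ≡ attachDegree (splitAt 5 u)
      -- The entries inside the pentagon compute to 2; among the old vertices only `a` is a
      -- neighbour, and only of x₁.
      count 0F = cong (2 +_) (sum-indicator₁ a)
      count 1F = cong (2 +_) (sum-zero {N})
      count 2F = cong (2 +_) (sum-zero {N})
      count 3F = cong (2 +_) (sum-zero {N})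
      count 4F = cong (2 +_) (sum-zero {N})
      count (suc (suc (suc (suc (suc v))))) = cong (δ v +_) (sym (length-filter (Graph.adj? G v) id))

    dist-attach : ∀ u v → dist (attach G a) u v ≡ attachDist G a G-connected (splitAt 5 u) (splitAt 5 v)
    dist-attach = dist-unique (attach-distance G a G-connected)

    sum-deg : sum deg ≡ suc S
    sum-deg = trans (∑-distrib-+ δ (degree G)) (cong (_+ S) (sum-indicator₁ a))

    δ-dist : ∀ v → δ v * dist G a v ≡ 0
    δ-dist v with v ≟ a
    ... | yes refl = trans (+-identityʳ _) (G.diagonal a)
    ... | no  _    = refl

    -- The extra unit of degree sits at `a`, at distance 0 from `a`.
    sum-deg-dist : sum (λ v → deg v * dist G a v) ≡ T
    sum-deg-dist = sum-cong-≗ λ v → trans (*-distribʳ-+ (dist G a v) (δ v) (degree G v))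
      (cong (_+ degree G v * dist G a v) (δ-dist v))

    -- This is the contribution of the old vertices to the transmission of a new vertex at distance
    -- `c` from x₁: each path has `c + 1` edges before it reaches `a`, and the old degrees now add
    -- up to `suc S`.
    crossing : ∀ c → sum (λ v → deg v * (c + suc (dist G a v))) ≡ suc c * suc S + T
    crossing c = begin
      sum (λ v → deg v * (c + suc (dist G a v)))
        ≡⟨ sum-cong-≗ (λ v → split (deg v) c (dist G a v)) ⟩
      sum (λ v → suc c * deg v + deg v * dist G a v)
        ≡⟨ ∑-distrib-+ (λ v → suc c * deg v) (λ v → deg v * dist G a v) ⟩
      sum (λ v → suc c * deg v) + sum (λ v → deg v * dist G a v)
        ≡⟨ cong₂ _+_ (trans (sym (*-distribˡ-sum (suc c) deg)) (cong (suc c *_) sum-deg)) sum-deg-dist ⟩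
      suc c * suc S + T ∎
      where
      open ≡-Reasoning
      split : ∀ x c d → x * (c + suc d) ≡ suc c * x + x * d
      split = solve-∀

    weighted-crossing : ∀ w c → sum (λ v → w * deg v * (c + suc (dist G a v))) ≡ w * (suc c * suc S + T)
    weighted-crossing w c = trans
      (sum-cong-≗ (λ v → *-assoc w (deg v) (c + suc (dist G a v))))
      (trans (sym (*-distribˡ-sum w (λ v → deg v * (c + suc (dist G a v))))) (cong (w *_) (crossing c)))

    -- Only pairs containing `a` notice its larger degree, and the pair of `a` and `v` gains
    -- `degree G v * dist G a v`.
    pairSum-deg : pairSum N (λ u v → deg u * deg v * dist G u v) ≡ Gut G + T
    pairSum-deg = begin
      pairSum N (λ u v → deg u * deg v * dist G u v)
        ≡⟨ pairSum-cong (λ u v → trans (expand (δ u) (degree G u) (δ v) (degree G v) (dist G u v)) (cong (degree G u * degree G v * dist G u v +_) (δ-terms u v))) ⟩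
      pairSum N (λ u v → degree G u * degree G v * dist G u v + (δ u * h v + h u * δ v))
        ≡⟨ pairSum-+ (λ u v → degree G u * degree G v * dist G u v) (λ u v → δ u * h v + h u * δ v) ⟩
      pairSum N (λ u v → degree G u * degree G v * dist G u v) + pairSum N (λ u v → δ u * h v + h u * δ v)
        ≡⟨ cong₂ _+_ (sym (Gut-pairSum G)) δ-pairs ⟩
      Gut G + T ∎
      where
      open ≡-Reasoning
      h : Fin N → ℕ
      h v = degree G v * dist G a v

      expand : ∀ x d y e z → (x + d) * (y + e) * z ≡ d * e * z + (x * (y * z) + x * (e * z) + d * (y * z))
      expand = solve-∀

      -- A factor `δ` puts one end of the pair at `a`, so the distance becomes one from `a`; if both
      -- ends are `a`, it is 0.
      δ-terms : ∀ u v → δ u * (δ v * dist G u v) + δ u * (degree G v * dist G u v) + degree G u * (δ v * dist G u v)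
        ≡ δ u * h v + h u * δ v
      δ-terms u v with u ≟ a | v ≟ a
      ... | yes refl | yes refl rewrite G.diagonal a = zeros (degree G a)
        where
        zeros : ∀ d → 1 * (1 * 0) + 1 * (d * 0) + d * (1 * 0) ≡ 1 * (d * 0) + d * 0 * 1
        zeros = solve-∀
      ... | yes refl | no  _    = ones (degree G u) (degree G v * dist G a v) (dist G u a)
        where
        ones : ∀ d x y → 0 + 1 * x + d * (0 * y) ≡ 1 * x + d * y * 0
        ones = solve-∀
      ... | no  _    | yes refl rewrite G.symmetric u a = ones (degree G u) (dist G a u)
        where
        ones : ∀ d y → 0 + 0 + d * (1 * y) ≡ 0 + d * y * 1
        ones = solve-∀
      ... | no  _    | no  _    = zeros (degree G u) (dist G a u)
        where
        zeros : ∀ d y → d * 0 ≡ d * y * 0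
        zeros = solve-∀

      -- Since `δ` has total 1, `sum δ * sum h` is `T`. In its expansion the diagonal contributes
      -- `h a`, which is 0.
      δ-pairs : pairSum N (λ u v → δ u * h v + h u * δ v) ≡ T
      δ-pairs = sym (begin
        T                                                       ≡⟨ sym (+-identityʳ T) ⟩
        sum h + 0                                               ≡⟨ cong (_+ 0) (sym (trans (cong (_* sum h) (sum-indicator₁ a)) (+-identityʳ (sum h)))) ⟩
        sum δ * sum h + 0                                       ≡⟨ cong (_+ 0) (sum-*-sum δ h) ⟩
        pairSum N (λ u v → δ u * h v + h u * δ v) + sum (λ v → δ v * h v) + 0
          ≡⟨ cong (λ x → pairSum N (λ u v → δ u * h v + h u * δ v) + x + 0)
               (trans (sum-indicator a h) (trans (cong (degree G a *_) (G.diagonal a)) (*-zeroʳ (degree G a)))) ⟩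
        pairSum N (λ u v → δ u * h v + h u * δ v) + 0 + 0       ≡⟨ trans (+-identityʳ _) (+-identityʳ _) ⟩
        pairSum N (λ u v → δ u * h v + h u * δ v)               ∎)

  -- Twice the six new edges. In the proof, 11 = 3 + 4 · 2 belongs to the new pentagon and one more
  -- unit to `a`.
  totalDegree-attach : totalDegree (attach G a) ≡ 12 + totalDegree G
  totalDegree-attach = trans (sum-cong-≗ degree-attach) (cong (11 +_) sum-deg)

  -- With all degrees 2, the five new vertices would contribute 2(1 + 1 + 2 + 2) = 12; the third
  -- edge at x₁ adds the distance to x₁ once more. The old vertices contribute as in `crossing`.
  transmission-attach : ∀ i → transmission (attach G a) (i ↑ˡ N)
    ≡ 12 + cycleDist i 0F + suc (cycleDist i 0F) * suc S + T
  transmission-attach i = begin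
    transmission (attach G a) (i ↑ˡ N)
      ≡⟨ sum-cong-≗ (λ v → cong₂ _*_ (degree-attach v)
           (trans (dist-attach (i ↑ˡ N) v) (cong (λ s → attachDist G a G-connected s (splitAt 5 v)) (splitAt-↑ˡ 5 i N)))) ⟩
    sum (λ v → attachDegree (splitAt 5 v) * attachDist G a G-connected (inj₁ i) (splitAt 5 v))
      ≡⟨ new-pentagon i _ ⟩
    12 + cycleDist i 0F + sum (λ v → deg v * (cycleDist i 0F + suc (dist G a v)))
      ≡⟨ cong (12 + cycleDist i 0F +_) (crossing (cycleDist i 0F)) ⟩
    12 + cycleDist i 0F + (suc (cycleDist i 0F) * suc S + T)
      ≡⟨ sym (+-assoc (12 + cycleDist i 0F) _ _) ⟩
    12 + cycleDist i 0F + suc (cycleDist i 0F) * suc S + T ∎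
    where
    open ≡-Reasoning
    new-pentagon : ∀ i x → 3 * cycleDist i 0F + (2 * cycleDist i 1F + (2 * cycleDist i 2F
      + (2 * cycleDist i 3F + (2 * cycleDist i 4F + x)))) ≡ 12 + cycleDist i 0F + x
    new-pentagon 0F x = refl
    new-pentagon 1F x = refl
    new-pentagon 2F x = refl
    new-pentagon 3F x = refl
    new-pentagon 4F x = refl

  -- The pairs inside the new pentagon give 72 = 60 + 12, the 12 coming from the third edge at x₁.
  -- The crossing pairs give 23 = 3·1 + 2·2 + 2·3 + 2·3 + 2·2 times `suc S` and 11 times `T`; the
  -- twelfth `T` is that of `pairSum-deg`.
  Gut-attach : Gut (attach G a) ≡ Gut G + 12 * T + (23 * suc S + 72)
  Gut-attach = begin
    Gut (attach G a)
      ≡⟨ Gut-pairSum (attach G a) ⟩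
    pairSum (5 + N) (λ u v → degree (attach G a) u * degree (attach G a) v * dist (attach G a) u v)
      ≡⟨ pairSum-cong (λ u v → cong₂ _*_ (cong₂ _*_ (degree-attach u) (degree-attach v)) (dist-attach u v)) ⟩
    pairSum (5 + N) (λ u v → attachDegree (splitAt 5 u) * attachDegree (splitAt 5 v)
      * attachDist G a G-connected (splitAt 5 u) (splitAt 5 v))
      ≡⟨ rows ⟩
    _
      ≡⟨ collect (suc S) T (Gut G) ⟩
    Gut G + 12 * T + (23 * suc S + 72) ∎
    where
    open ≡-Reasoning
    -- The shape of the unfolded `pairSum`: numerals come from pairs inside the new pentagon, `a₁`
    -- to `a₅` from the crossing pairs at x₁ to x₅, and `r` from pairs inside `G`.
    split-rows : ∀ {a₁ a₂ a₃ a₄ a₅ b₁ b₂ b₃ b₄ b₅ r s} →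
      a₁ ≡ b₁ → a₂ ≡ b₂ → a₃ ≡ b₃ → a₄ ≡ b₄ → a₅ ≡ b₅ → r ≡ s →
      (6 + (12 + (12 + (6 + a₁)))) + ((4 + (8 + (8 + a₂))) + ((4 + (8 + a₃)) + ((4 + a₄) + (a₅ + r))))
      ≡ (6 + (12 + (12 + (6 + b₁)))) + ((4 + (8 + (8 + b₂))) + ((4 + (8 + b₃)) + ((4 + b₄) + (b₅ + s))))
    split-rows refl refl refl refl refl refl = refl
    rows = split-rows (weighted-crossing 3 0) (weighted-crossing 2 1) (weighted-crossing 2 2)
      (weighted-crossing 2 2) (weighted-crossing 2 1) pairSum-deg
    collect : ∀ s t g →
      (6 + (12 + (12 + (6 + 3 * (1 * s + t))))) + ((4 + (8 + (8 + 2 * (2 * s + t))))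
        + ((4 + (8 + 2 * (3 * s + t))) + ((4 + 2 * (3 * s + t)) + (2 * (2 * s + t) + (g + t)))))
      ≡ g + 12 * t + (23 * s + 72)
    collect = solve-∀

-- Chains

pentagon-connected : Connected pentagon
pentagon-connected = connected pentagon-distance

PG-connected : ∀ u₁ {n} (h : History n) → Connected (PG u₁ h)
PG-connected u₁ one        = pentagon-connected
PG-connected u₁ two        = connected (attach-distance pentagon u₁ pentagon-connected)
PG-connected u₁ (grow h c) = connected (attach-distance (PG u₁ h) _ (PG-connected u₁ h))

totalDegree-PG : ∀ u₁ {m} (h : History (suc m)) → totalDegree (PG u₁ h) ≡ 10 + 12 * m
totalDegree-PG u₁ one            = refl
totalDegree-PG u₁ two            = totalDegree-attach pentagon u₁ pentagon-connected
totalDegree-PG u₁ (grow {k} h c) = begin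
  totalDegree (PG u₁ (grow h c))  ≡⟨ totalDegree-attach (PG u₁ h) _ (PG-connected u₁ h) ⟩
  12 + totalDegree (PG u₁ h)      ≡⟨ cong (12 +_) (totalDegree-PG u₁ h) ⟩
  12 + (10 + 12 * suc k)          ≡⟨ next k ⟩
  10 + 12 * (2 + k)               ∎
  where
  open ≡-Reasoning
  next : ∀ k → 12 + (10 + 12 * suc k) ≡ 10 + 12 * (2 + k)
  next = solve-∀

-- The transmission of uₙ₋₁ in PGₙ₋₁, for the chain PGₙ given by a history.
rootTransmission : Fin 5 → ∀ {k} → History (2 + k) → ℕ
rootTransmission u₁ two            = transmission pentagon u₁
rootTransmission u₁ (grow {k} h c) = transmission (PG u₁ h) (vertex c ↑ˡ (1 + k) * 5)

rootTransmission-two : ∀ u₁ → rootTransmission u₁ two ≡ 12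
rootTransmission-two = from-yes (all? λ u₁ → transmission pentagon u₁ ℕ.≟ 12)

-- The first value is for distance 1 from x₁, the second for distance 2.
byDistance : A → A → Choice → A
byDistance a b x₂ = a
byDistance a b x₃ = b
byDistance a b x₄ = b
byDistance a b x₅ = a

rootTransmission-grow : ∀ u₁ {k} (h : History (2 + k)) c →
  rootTransmission u₁ (grow h c) ≡ rootTransmission u₁ h + byDistance (35 + 24 * k) (47 + 36 * k) c
rootTransmission-grow u₁ {k} h c = trans (step h) (evaluate c (rootTransmission u₁ h))
  where
  e = cycleDist (vertex c) 0F

  -- Cases on `h` expose `PG u₁ h` as an `attach`. The chain before its last pentagon has `1 + k`
  -- pentagons and total degree `10 + 12 * k`.
  step : ∀ {k} (h : History (2 + k)) →
    rootTransmission u₁ (grow h c) ≡ 12 + e + suc e * (11 + 12 * k) + rootTransmission u₁ h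
  step two = transmission-attach pentagon u₁ pentagon-connected (vertex c)
  step (grow {k} h c′) = trans (transmission-attach (PG u₁ h) _ (PG-connected u₁ h) (vertex c))
    (cong (λ s → 12 + e + suc e * suc s + rootTransmission u₁ (grow h c′)) (totalDegree-PG u₁ h))

  near : ∀ t k → 13 + 2 * (11 + 12 * k) + t ≡ t + (35 + 24 * k)
  near = solve-∀
  far : ∀ t k → 14 + 3 * (11 + 12 * k) + t ≡ t + (47 + 36 * k)
  far = solve-∀

  evaluate : ∀ c t → let e = cycleDist (vertex c) 0F in
    12 + e + suc e * (11 + 12 * k) + t ≡ t + byDistance (35 + 24 * k) (47 + 36 * k) c
  evaluate x₂ t = near t k
  evaluate x₃ t = far t k
  evaluate x₄ t = far t k
  evaluate x₅ t = near t k

Gut-pentagon : Gut pentagon ≡ 60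
Gut-pentagon = refl

Gut-two : ∀ u₁ → Gut (PG u₁ two) ≡ 529
Gut-two u₁ = trans (Gut-attach pentagon u₁ pentagon-connected)
  evaluate
  where
  -- 325 = 23 · 11 + 72, where 10 is the total degree of the pentagon; then 60 + 12 · 12 + 325 =
  -- 529.
  evaluate = cong (λ t → Gut pentagon + 12 * t + 325) (rootTransmission-two u₁)

-- `Gut-attach` involves the transmission of the newly chosen vertex, which `rootTransmission-grow`
-- traces back to `h`; the choice then affects only the last summand.
Gut-grow : ∀ u₁ {k} (h : History (2 + k)) c →
  Gut (PG u₁ (grow h c)) ≡ Gut (PG u₁ h) + 12 * rootTransmission u₁ h
    + byDistance (1021 + 564 * k) (1165 + 708 * k) c
Gut-grow u₁ {k} h c = begin
  Gut (PG u₁ (grow h c))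
    ≡⟨ Gut-attach (PG u₁ h) _ (PG-connected u₁ h) ⟩
  Gut (PG u₁ h) + 12 * rootTransmission u₁ (grow h c) + (23 * suc (totalDegree (PG u₁ h)) + 72)
    ≡⟨ cong₂ (λ t s → Gut (PG u₁ h) + 12 * t + (23 * suc s + 72)) (rootTransmission-grow u₁ h c) (totalDegree-PG u₁ h) ⟩
  Gut (PG u₁ h) + 12 * (rootTransmission u₁ h + byDistance (35 + 24 * k) (47 + 36 * k) c) + (23 * (11 + 12 * suc k) + 72)
    ≡⟨ evaluate c (Gut (PG u₁ h)) (rootTransmission u₁ h) ⟩
  Gut (PG u₁ h) + 12 * rootTransmission u₁ h + byDistance (1021 + 564 * k) (1165 + 708 * k) c ∎
  where
  open ≡-Reasoning
  near : ∀ g t k → g + 12 * (t + (35 + 24 * k)) + (23 * (11 + 12 * suc k) + 72) ≡ g + 12 * t + (1021 + 564 * k)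
  near = solve-∀
  far : ∀ g t k → g + 12 * (t + (47 + 36 * k)) + (23 * (11 + 12 * suc k) + 72) ≡ g + 12 * t + (1165 + 708 * k)
  far = solve-∀
  evaluate : ∀ c g t → g + 12 * (t + byDistance (35 + 24 * k) (47 + 36 * k) c) + (23 * (11 + 12 * suc k) + 72)
    ≡ g + 12 * t + byDistance (1021 + 564 * k) (1165 + 708 * k) c
  evaluate x₂ g t = near g t k
  evaluate x₃ g t = far g t k
  evaluate x₄ g t = far g t k
  evaluate x₅ g t = near g t k

-- Expectations

module _ {c ℓ₁ ℓ₂} (R : OrderedCommutativeRing c ℓ₁ ℓ₂) where
  open OrderedCommutativeRing R hiding (_≤_) renaming (+-identityʳ to +ᴿ-identityʳ; refl to ≈-refl; sym to ≈-sym; trans to ≈-trans; zero to *-zero)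
  open import Relation.Binary.Reasoning.Setoid setoid
  open import Algebra.Properties.Semiring.Mult semiring using (×-homo-+; ×1-homo-*; ×-homo-1)
  open import Algebra.Solver.Ring.NaturalCoefficients.Default commutativeSemiring
    using (solve; _:=_; _:+_; _:*_; con)

  -- Natural numbers in the ring and the cubic polynomial

  ι-+ : ∀ m n → ι (m + n) ≈ ι m +ᴿ ι n
  ι-+ = ×-homo-+ 1#

  ι-* : ∀ m n → ι (m * n) ≈ ι m *ᴿ ι n
  ι-* = ×1-homo-*

  open import Algebra.Properties.Semiring.Mult.TCOptimised semiring using (×ᵤ≈×) renaming (_×_ to _×′_)
  open import Algebra.Properties.Ring ring using (-1*x≈-x)

  private
    -- The form in which the solver evaluates `con m`, so that statements in `κ` match its output by
    -- computation.
    κ : ℕ → Carrier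
    κ m = m ×′ 1#

    ι≈κ : ∀ m → ι m ≈ κ m
    ι≈κ m = ×ᵤ≈× m 1#

  -- The subtractions are avoided twice: by moving negative terms across the hypotheses,
  -- and by writing −x as z x with z = −1, so that a semiring solver suffices.
  closed-form : ∀ {p q} → p +ᴿ q ≈ 1# → ∀ n f g →
    f + (47 * n + 1) ≡ 48 * (n * (n * n)) + 60 * (n * n) →
    g + (12 * (n * n) + 1) ≡ 72 * (n * (n * n)) + n →
    p *ᴿ ι f +ᴿ q *ᴿ ι g
      ≈ (ι 72 -ᴿ ι 24 *ᴿ p) *ᴿ ι n ^ᴿ 3
        +ᴿ (ι 72 *ᴿ p -ᴿ ι 12) *ᴿ ι n ^ᴿ 2
        +ᴿ (1# -ᴿ ι 48 *ᴿ p) *ᴿ ι n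
        -ᴿ 1#
  closed-form {p} {q} p+q≈1 n f g f-eq g-eq = begin
    X
      -- Adds `(1# +ᴿ z) *ᴿ neg`, which is zero, to produce `X +ᴿ neg`, whose value `pos` is found
      -- without subtraction.
      ≈⟨ ≈-trans (+-congˡ (≈-trans (*-congʳ (-‿inverseʳ 1#)) (zeroˡ neg))) (+ᴿ-identityʳ X) ⟨
    X +ᴿ (1# +ᴿ z) *ᴿ neg
      ≈⟨ solve 3 (λ x z m → x :+ (con 1 :+ z) :* m := x :+ m :+ z :* m) ≈-refl X z neg ⟩
    X +ᴿ neg +ᴿ z *ᴿ neg
      ≈⟨ +-congʳ X+neg≈pos ⟩
    pos +ᴿ z *ᴿ neg
      ≈⟨ solve 3 (λ p ν z →
           con 72 :* (ν :* (ν :* ν)) :+ con 72 :* p :* (ν :* ν) :+ ν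
             :+ z :* (con 24 :* p :* (ν :* (ν :* ν)) :+ con 12 :* (ν :* ν) :+ con 48 :* p :* ν :+ con 1)
           := (con 72 :+ z :* (con 24 :* p)) :* (ν :* (ν :* (ν :* con 1)))
             :+ (con 72 :* p :+ z :* con 12) :* (ν :* (ν :* con 1))
             :+ (con 1 :+ z :* (con 48 :* p)) :* ν
             :+ z) ≈-refl p ν z ⟩
    (κ 72 +ᴿ z *ᴿ (κ 24 *ᴿ p)) *ᴿ ν ^ᴿ 3 +ᴿ (κ 72 *ᴿ p +ᴿ z *ᴿ κ 12) *ᴿ ν ^ᴿ 2 +ᴿ (1# +ᴿ z *ᴿ (κ 48 *ᴿ p)) *ᴿ ν +ᴿ z
      ≈⟨ +-congʳ (+-cong (+-cong
           (*-congʳ (+-cong (≈-sym (ι≈κ 72)) (negate (*-congʳ (ι≈κ 24)))))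
           (*-congʳ (+-cong (*-congʳ (≈-sym (ι≈κ 72))) (negate (ι≈κ 12)))))
           (*-congʳ (+-congˡ (negate (*-congʳ (ι≈κ 48)))))) ⟩
    (ι 72 -ᴿ ι 24 *ᴿ p) *ᴿ ν ^ᴿ 3 +ᴿ (ι 72 *ᴿ p -ᴿ ι 12) *ᴿ ν ^ᴿ 2 +ᴿ (1# -ᴿ ι 48 *ᴿ p) *ᴿ ν -ᴿ 1# ∎
    where
    ν = ι n
    z = - 1#
    X = p *ᴿ ι f +ᴿ q *ᴿ ι g
    pos = κ 72 *ᴿ (ν *ᴿ (ν *ᴿ ν)) +ᴿ κ 72 *ᴿ p *ᴿ (ν *ᴿ ν) +ᴿ ν
    neg = κ 24 *ᴿ p *ᴿ (ν *ᴿ (ν *ᴿ ν)) +ᴿ κ 12 *ᴿ (ν *ᴿ ν) +ᴿ κ 48 *ᴿ p *ᴿ ν +ᴿ 1#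

    negate : ∀ {x y} → y ≈ x → z *ᴿ x ≈ - y
    negate {x} {y} y≈x = ≈-trans (*-congˡ (≈-sym y≈x)) (-1*x≈-x y)

    scale : ∀ m x {y} → ι x ≈ y → ι (m * x) ≈ κ m *ᴿ y
    scale m x eq = ≈-trans (ι-* m x) (*-cong (ι≈κ m) eq)

    square : ι (n * n) ≈ ν *ᴿ ν
    square = ι-* n n

    cube : ι (n * (n * n)) ≈ ν *ᴿ (ν *ᴿ ν)
    cube = ≈-trans (ι-* n (n * n)) (*-congˡ square)

    sum-of : ∀ x y {a b} → ι x ≈ a → ι y ≈ b → ι (x + y) ≈ a +ᴿ b
    sum-of x y x≈a y≈b = ≈-trans (ι-+ x y) (+-cong x≈a y≈b)

    f-value : ι f +ᴿ (κ 47 *ᴿ ν +ᴿ 1#) ≈ κ 48 *ᴿ (ν *ᴿ (ν *ᴿ ν)) +ᴿ κ 60 *ᴿ (ν *ᴿ ν)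
    f-value = begin
      ι f +ᴿ (κ 47 *ᴿ ν +ᴿ 1#)
        ≈⟨ sum-of f (47 * n + 1) ≈-refl (sum-of (47 * n) 1 (scale 47 n ≈-refl) (×-homo-1 1#)) ⟨
      ι (f + (47 * n + 1))
        ≈⟨ reflexive (cong ι f-eq) ⟩
      ι (48 * (n * (n * n)) + 60 * (n * n))
        ≈⟨ sum-of (48 * (n * (n * n))) (60 * (n * n)) (scale 48 (n * (n * n)) cube) (scale 60 (n * n) square) ⟩
      κ 48 *ᴿ (ν *ᴿ (ν *ᴿ ν)) +ᴿ κ 60 *ᴿ (ν *ᴿ ν) ∎

    g-value : ι g +ᴿ (κ 12 *ᴿ (ν *ᴿ ν) +ᴿ 1#) ≈ κ 72 *ᴿ (ν *ᴿ (ν *ᴿ ν)) +ᴿ ν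
    g-value = begin
      ι g +ᴿ (κ 12 *ᴿ (ν *ᴿ ν) +ᴿ 1#)
        ≈⟨ sum-of g (12 * (n * n) + 1) ≈-refl (sum-of (12 * (n * n)) 1 (scale 12 (n * n) square) (×-homo-1 1#)) ⟨
      ι (g + (12 * (n * n) + 1))
        ≈⟨ reflexive (cong ι g-eq) ⟩
      ι (72 * (n * (n * n)) + n)
        ≈⟨ sum-of (72 * (n * (n * n))) n (scale 72 (n * (n * n)) cube) ≈-refl ⟩
      κ 72 *ᴿ (ν *ᴿ (ν *ᴿ ν)) +ᴿ ν ∎

    -- Makes every term without a factor `p` or `q` linear in them, so that the coefficients of `p`
    -- and `q` can be treated separately, by `f-value` and `g-value`.
    homogenise : ∀ x → x ≈ x *ᴿ (p +ᴿ q)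
    homogenise x = ≈-sym (≈-trans (*-congˡ p+q≈1) (*-identityʳ x))

    X+neg≈pos : X +ᴿ neg ≈ pos
    X+neg≈pos = begin
      X +ᴿ neg
        ≈⟨ +-congˡ (+-cong (+-congʳ (+-congˡ (homogenise (κ 12 *ᴿ (ν *ᴿ ν))))) (≈-sym p+q≈1)) ⟩
      X +ᴿ (κ 24 *ᴿ p *ᴿ (ν *ᴿ (ν *ᴿ ν)) +ᴿ κ 12 *ᴿ (ν *ᴿ ν) *ᴿ (p +ᴿ q) +ᴿ κ 48 *ᴿ p *ᴿ ν +ᴿ (p +ᴿ q))
        ≈⟨ solve 5 (λ p q ν φ γ →
             p :* φ :+ q :* γ
               :+ (con 24 :* p :* (ν :* (ν :* ν)) :+ con 12 :* (ν :* ν) :* (p :+ q) :+ con 48 :* p :* ν :+ (p :+ q))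
             := p :* (φ :+ (con 47 :* ν :+ con 1)) :+ q :* (γ :+ (con 12 :* (ν :* ν) :+ con 1))
               :+ (con 24 :* p :* (ν :* (ν :* ν)) :+ con 12 :* p :* (ν :* ν) :+ p :* ν)) ≈-refl p q ν (ι f) (ι g) ⟩
      p *ᴿ (ι f +ᴿ (κ 47 *ᴿ ν +ᴿ 1#)) +ᴿ q *ᴿ (ι g +ᴿ (κ 12 *ᴿ (ν *ᴿ ν) +ᴿ 1#)) +ᴿ rest
        ≈⟨ +-congʳ (+-cong (*-congˡ f-value) (*-congˡ g-value)) ⟩
      p *ᴿ (κ 48 *ᴿ (ν *ᴿ (ν *ᴿ ν)) +ᴿ κ 60 *ᴿ (ν *ᴿ ν)) +ᴿ q *ᴿ (κ 72 *ᴿ (ν *ᴿ (ν *ᴿ ν)) +ᴿ ν) +ᴿ rest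
        ≈⟨ solve 3 (λ p q ν →
             p :* (con 48 :* (ν :* (ν :* ν)) :+ con 60 :* (ν :* ν)) :+ q :* (con 72 :* (ν :* (ν :* ν)) :+ ν)
               :+ (con 24 :* p :* (ν :* (ν :* ν)) :+ con 12 :* p :* (ν :* ν) :+ p :* ν)
             := con 72 :* (ν :* (ν :* ν)) :* (p :+ q) :+ con 72 :* p :* (ν :* ν) :+ ν :* (p :+ q)) ≈-refl p q ν ⟩
      κ 72 *ᴿ (ν *ᴿ (ν *ᴿ ν)) *ᴿ (p +ᴿ q) +ᴿ κ 72 *ᴿ p *ᴿ (ν *ᴿ ν) +ᴿ ν *ᴿ (p +ᴿ q)
        ≈⟨ +-cong (+-congʳ (homogenise (κ 72 *ᴿ (ν *ᴿ (ν *ᴿ ν))))) (homogenise ν) ⟨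
      pos ∎
      where
      rest = κ 24 *ᴿ p *ᴿ (ν *ᴿ (ν *ᴿ ν)) +ᴿ κ 12 *ᴿ p *ᴿ (ν *ᴿ ν) +ᴿ p *ᴿ ν

  -- Expectations over histories and their recursions

  module _ {p₁ p₂ : Carrier} (law : Law R p₁ p₂) (p₁+p₂≈1 : p₁ +ᴿ p₂ ≈ 1#) where
    open Law law

    private
      E : ∀ {n} → (History n → Carrier) → Carrier
      E = 𝔼 R law

      P : ∀ {n} → History n → Carrier
      P = prob R law

      -- The partial sum over an arbitrary list of histories, as needed for induction on the list.
      E-list : ∀ {n} → (History n → Carrier) → List (History n) → Carrier
      E-list X = foldr (λ h s → P h *ᴿ X h +ᴿ s) 0#

    E-+ : ∀ {n} (X Y : History n → Carrier) → E (λ h → X h +ᴿ Y h) ≈ E X +ᴿ E Y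
    E-+ {n} X Y = go (histories n)
      where
      go : ∀ hs → E-list (λ h → X h +ᴿ Y h) hs ≈ E-list X hs +ᴿ E-list Y hs
      go []       = ≈-sym (+-identityˡ 0#)
      go (h ∷ hs) = ≈-trans (+-congˡ (go hs))
        (solve 5 (λ p x y s t → p :* (x :+ y) :+ (s :+ t) := p :* x :+ s :+ (p :* y :+ t)) ≈-refl
          (P h) (X h) (Y h) (E-list X hs) (E-list Y hs))

    E-cong : ∀ n {X Y : History n → Carrier} → (∀ h → X h ≈ Y h) → E X ≈ E Y
    E-cong n {X} {Y} eq = go (histories n)
      where
      go : ∀ hs → E-list X hs ≈ E-list Y hs
      go []       = ≈-refl
      go (h ∷ hs) = +-cong (*-congˡ (eq h)) (go hs)

    E-* : ∀ {n} a (X : History n → Carrier) → E (λ h → a *ᴿ X h) ≈ a *ᴿ E X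
    E-* {n} a X = go (histories n)
      where
      go : ∀ hs → E-list (λ h → a *ᴿ X h) hs ≈ a *ᴿ E-list X hs
      go []       = ≈-sym (zeroʳ a)
      go (h ∷ hs) = ≈-trans (+-congˡ (go hs))
        (solve 4 (λ p a x s → p :* (a :* x) :+ a :* s := a :* (p :* x :+ s)) ≈-refl (P h) a (X h) (E-list X hs))

    private
      -- The conditional expectation over the next choice, given `h`.
      mean : ∀ {k} → History (2 + k) → (Choice → Carrier) → Carrier
      mean h f = weight h x₂ *ᴿ f x₂ +ᴿ (weight h x₃ *ᴿ f x₃ +ᴿ (weight h x₄ *ᴿ f x₄ +ᴿ weight h x₅ *ᴿ f x₅))

    -- The tower property: each `h` is listed with its four extensions, whose probabilities are
    -- `prob h` times the conditional weights.
    E-tower : ∀ {k} (X : History (3 + k) → Carrier) → E X ≈ E (λ h → mean h (λ x → X (grow h x)))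
    E-tower {k} X = go (histories (2 + k))
      where
      go : ∀ hs → E-list X (cartesianProductWith grow hs choices) ≈ E-list (λ h → mean h (λ x → X (grow h x))) hs
      go []       = ≈-refl
      go (h ∷ hs) = ≈-trans
        (+-congˡ (+-congˡ (+-congˡ (+-congˡ (go hs)))))
        (solve 10 (λ p s w₂ y₂ w₃ y₃ w₄ y₄ w₅ y₅ →
            p :* w₂ :* y₂ :+ (p :* w₃ :* y₃ :+ (p :* w₄ :* y₄ :+ (p :* w₅ :* y₅ :+ s)))
            := p :* (w₂ :* y₂ :+ (w₃ :* y₃ :+ (w₄ :* y₄ :+ w₅ :* y₅))) :+ s) ≈-refl
          (P h) (E-list (λ h → mean h (λ x → X (grow h x))) hs)
          (weight h x₂) (X (grow h x₂)) (weight h x₃) (X (grow h x₃))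
          (weight h x₄) (X (grow h x₄)) (weight h x₅) (X (grow h x₅)))

    -- Equal values at x₂, x₅ and at x₃, x₄ collect the weights into the prescribed sums, so the
    -- split within each pair disappears.
    mean-byDistance : ∀ {k} (h : History (2 + k)) y α β →
      mean h (λ x → y +ᴿ byDistance α β x) ≈ y +ᴿ (p₁ *ᴿ α +ᴿ p₂ *ᴿ β)
    mean-byDistance h y α β = begin
      mean h (λ x → y +ᴿ byDistance α β x)
        ≈⟨ solve 7 (λ w₂ w₃ w₄ w₅ y α β →
             w₂ :* (y :+ α) :+ (w₃ :* (y :+ β) :+ (w₄ :* (y :+ β) :+ w₅ :* (y :+ α)))
             := (w₂ :+ w₅ :+ (w₃ :+ w₄)) :* y :+ ((w₂ :+ w₅) :* α :+ (w₃ :+ w₄) :* β)) ≈-refl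
             (weight h x₂) (weight h x₃) (weight h x₄) (weight h x₅) y α β ⟩
      (near +ᴿ far) *ᴿ y +ᴿ (near *ᴿ α +ᴿ far *ᴿ β)
        ≈⟨ +-cong (*-congʳ (+-cong (weight-p₁ h) (weight-p₂ h))) (+-cong (*-congʳ (weight-p₁ h)) (*-congʳ (weight-p₂ h))) ⟩
      (p₁ +ᴿ p₂) *ᴿ y +ᴿ (p₁ *ᴿ α +ᴿ p₂ *ᴿ β)
        ≈⟨ +-congʳ (≈-trans (*-congʳ p₁+p₂≈1) (*-identityˡ y)) ⟩
      y +ᴿ (p₁ *ᴿ α +ᴿ p₂ *ᴿ β) ∎
      where
      near = weight h x₂ +ᴿ weight h x₅
      far  = weight h x₃ +ᴿ weight h x₄

    average-constant : ∀ x → x ≈ p₁ *ᴿ x +ᴿ p₂ *ᴿ x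
    average-constant x = begin
      x                     ≈⟨ *-identityˡ x ⟨
      1# *ᴿ x               ≈⟨ *-congʳ p₁+p₂≈1 ⟨
      (p₁ +ᴿ p₂) *ᴿ x       ≈⟨ distribʳ x p₁ p₂ ⟩
      p₁ *ᴿ x +ᴿ p₂ *ᴿ x    ∎

    -- The total probability is 1: the tower property removes one choice at a time, and each
    -- conditional mean of a constant is that constant.
    E-constant : ∀ k a → E {2 + k} (λ _ → a) ≈ a
    E-constant zero    a = ≈-trans (+ᴿ-identityʳ _) (*-identityˡ a)
    E-constant (suc k) a = begin
      E {3 + k} (λ _ → a)
        ≈⟨ E-tower {k} (λ _ → a) ⟩
      E {2 + k} (λ h → mean h (λ _ → a))
        ≈⟨ E-cong (2 + k) (λ h → ≈-trans (mean-cong h) (mean-byDistance h 0# a a)) ⟩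
      E {2 + k} (λ _ → 0# +ᴿ (p₁ *ᴿ a +ᴿ p₂ *ᴿ a))
        ≈⟨ E-cong (2 + k) (λ _ → ≈-trans (+-identityˡ _) (≈-sym (average-constant a))) ⟩
      E {2 + k} (λ _ → a)
        ≈⟨ E-constant k a ⟩
      a ∎
      where
      -- Puts the constant in the form to which `mean-byDistance` applies.
      mean-cong : ∀ {k} (h : History (2 + k)) → mean h (λ _ → a) ≈ mean h (λ x → 0# +ᴿ byDistance a a x)
      mean-cong h = +-cong (*-congˡ e) (+-cong (*-congˡ e) (+-cong (*-congˡ e) (*-congˡ e)))
        where e = ≈-sym (+-identityˡ a)

    -- The conditional mean of the increment does not depend on `h`, which gives a linear recursion
    -- for the expectations.
    E-step : ∀ {k} (X : History (3 + k) → ℕ) (Y : History (2 + k) → ℕ) a b →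
      (∀ h x → X (grow h x) ≡ Y h + byDistance a b x) →
      E (λ h → ι (X h)) ≈ E (λ h → ι (Y h)) +ᴿ (p₁ *ᴿ ι a +ᴿ p₂ *ᴿ ι b)
    E-step {k} X Y a b eq = begin
      E (λ h → ι (X h))
        ≈⟨ E-tower (λ h → ι (X h)) ⟩
      E (λ h → mean h (λ x → ι (X (grow h x))))
        ≈⟨ E-cong (2 + k) (λ h → +-cong (*-congˡ (value h x₂)) (+-cong (*-congˡ (value h x₃))
             (+-cong (*-congˡ (value h x₄)) (*-congˡ (value h x₅))))) ⟩
      E (λ h → mean h (λ x → ι (Y h) +ᴿ byDistance (ι a) (ι b) x))
        ≈⟨ E-cong (2 + k) (λ h → mean-byDistance h (ι (Y h)) (ι a) (ι b)) ⟩
      E (λ h → ι (Y h) +ᴿ (p₁ *ᴿ ι a +ᴿ p₂ *ᴿ ι b))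
        ≈⟨ E-+ (λ h → ι (Y h)) (λ _ → p₁ *ᴿ ι a +ᴿ p₂ *ᴿ ι b) ⟩
      E (λ h → ι (Y h)) +ᴿ E {2 + k} (λ _ → p₁ *ᴿ ι a +ᴿ p₂ *ᴿ ι b)
        ≈⟨ +-congˡ (E-constant k _) ⟩
      E (λ h → ι (Y h)) +ᴿ (p₁ *ᴿ ι a +ᴿ p₂ *ᴿ ι b) ∎
      where
      ι-byDistance : ∀ x → ι (byDistance a b x) ≈ byDistance (ι a) (ι b) x
      ι-byDistance x₂ = ≈-refl
      ι-byDistance x₃ = ≈-refl
      ι-byDistance x₄ = ≈-refl
      ι-byDistance x₅ = ≈-refl

      value : ∀ h x → ι (X (grow h x)) ≈ ι (Y h) +ᴿ byDistance (ι a) (ι b) x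
      value h x = ≈-trans (reflexive (cong ι (eq h x)))
        (≈-trans (ι-+ (Y h) (byDistance a b x)) (+-congˡ (ι-byDistance x)))

    -- Averages with natural coefficients are closed under sums and multiples, so the recursions
    -- reduce to identities between natural numbers.
    average-+ : ∀ a b a′ b′ → (p₁ *ᴿ ι a +ᴿ p₂ *ᴿ ι b) +ᴿ (p₁ *ᴿ ι a′ +ᴿ p₂ *ᴿ ι b′)
      ≈ p₁ *ᴿ ι (a + a′) +ᴿ p₂ *ᴿ ι (b + b′)
    average-+ a b a′ b′ = ≈-trans
      (solve 6 (λ p q a b a′ b′ → p :* a :+ q :* b :+ (p :* a′ :+ q :* b′) := p :* (a :+ a′) :+ q :* (b :+ b′))
        ≈-refl p₁ p₂ (ι a) (ι b) (ι a′) (ι b′))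
      (≈-sym (+-cong (*-congˡ (ι-+ a a′)) (*-congˡ (ι-+ b b′))))

    average-* : ∀ m a b → ι m *ᴿ (p₁ *ᴿ ι a +ᴿ p₂ *ᴿ ι b) ≈ p₁ *ᴿ ι (m * a) +ᴿ p₂ *ᴿ ι (m * b)
    average-* m a b = ≈-trans
      (solve 5 (λ p q m a b → m :* (p :* a :+ q :* b) := p :* (m :* a) :+ q :* (m :* b))
        ≈-refl p₁ p₂ (ι m) (ι a) (ι b))
      (≈-sym (+-cong (*-congˡ (ι-* m a)) (*-congˡ (ι-* m b))))

    average-≡ : ∀ {a a′ b b′} → a ≡ a′ → b ≡ b′ → p₁ *ᴿ ι a +ᴿ p₂ *ᴿ ι b ≈ p₁ *ᴿ ι a′ +ᴿ p₂ *ᴿ ι b′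
    average-≡ refl refl = ≈-refl

    -- With n = 2 + k, gut₁ k = 48n³ + 60n² − 47n − 1 and gut₂ k = 72n³ − 12n² + n − 1
    -- are the values of the closed form at p₁ = 1 and p₁ = 0.
    private
      root₁ root₂ gut₁ gut₂ : ℕ → ℕ
      root₁ k = 12 + 23 * k + 12 * (k * k)
      root₂ k = 12 + 29 * k + 18 * (k * k)
      gut₁ k = 529 + 769 * k + 348 * (k * k) + 48 * (k * k * k)
      gut₂ k = 529 + 817 * k + 420 * (k * k) + 72 * (k * k * k)

    -- Summing the increments from the initial value 12: `root₁ k` adds 35 + 24j, and `root₂ k` adds
    -- 47 + 36j, over all j < k.
    E-rootTransmission : ∀ u₁ k → E {2 + k} (λ h → ι (rootTransmission u₁ h)) ≈ p₁ *ᴿ ι (root₁ k) +ᴿ p₂ *ᴿ ι (root₂ k)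
    E-rootTransmission u₁ zero = begin
      1# *ᴿ ι (rootTransmission u₁ two) +ᴿ 0#  ≈⟨ ≈-trans (+ᴿ-identityʳ _) (*-identityˡ _) ⟩
      ι (rootTransmission u₁ two)             ≈⟨ reflexive (cong ι (rootTransmission-two u₁)) ⟩
      ι 12                                    ≈⟨ average-constant (ι 12) ⟩
      p₁ *ᴿ ι 12 +ᴿ p₂ *ᴿ ι 12                ∎
    E-rootTransmission u₁ (suc k) = begin
      E {3 + k} (λ h → ι (rootTransmission u₁ h))
        ≈⟨ E-step {k} (rootTransmission u₁) (rootTransmission u₁) a b (rootTransmission-grow u₁) ⟩
      E {2 + k} (λ h → ι (rootTransmission u₁ h)) +ᴿ (p₁ *ᴿ ι a +ᴿ p₂ *ᴿ ι b)
        ≈⟨ +-congʳ (E-rootTransmission u₁ k) ⟩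
      (p₁ *ᴿ ι (root₁ k) +ᴿ p₂ *ᴿ ι (root₂ k)) +ᴿ (p₁ *ᴿ ι a +ᴿ p₂ *ᴿ ι b)
        ≈⟨ average-+ (root₁ k) (root₂ k) a b ⟩
      p₁ *ᴿ ι (root₁ k + a) +ᴿ p₂ *ᴿ ι (root₂ k + b)
        ≈⟨ average-≡ (near k) (far k) ⟩
      p₁ *ᴿ ι (root₁ (suc k)) +ᴿ p₂ *ᴿ ι (root₂ (suc k)) ∎
      where
      a = 35 + 24 * k
      b = 47 + 36 * k
      near : ∀ k → 12 + 23 * k + 12 * (k * k) + (35 + 24 * k) ≡ 12 + 23 * suc k + 12 * (suc k * suc k)
      near = solve-∀
      far : ∀ k → 12 + 29 * k + 18 * (k * k) + (47 + 36 * k) ≡ 12 + 29 * suc k + 18 * (suc k * suc k)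
      far = solve-∀

    E-Gut-step : ∀ u₁ k f g → E {2 + k} (λ h → ι (Gut (PG u₁ h))) ≈ p₁ *ᴿ ι f +ᴿ p₂ *ᴿ ι g →
      E {3 + k} (λ h → ι (Gut (PG u₁ h)))
      ≈ p₁ *ᴿ ι (f + 12 * root₁ k + (1021 + 564 * k)) +ᴿ p₂ *ᴿ ι (g + 12 * root₂ k + (1165 + 708 * k))
    E-Gut-step u₁ k f g ih = begin
      E {3 + k} (λ h → ι (Gut (PG u₁ h)))
        ≈⟨ E-step {k} (λ h → Gut (PG u₁ h)) (λ h → Gut (PG u₁ h) + 12 * rootTransmission u₁ h) a b (Gut-grow u₁) ⟩
      E {2 + k} (λ h → ι (Gut (PG u₁ h) + 12 * rootTransmission u₁ h)) +ᴿ (p₁ *ᴿ ι a +ᴿ p₂ *ᴿ ι b)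
        ≈⟨ +-congʳ (E-cong (2 + k) (λ h → ≈-trans (ι-+ (Gut (PG u₁ h)) (12 * rootTransmission u₁ h)) (+-congˡ (ι-* 12 (rootTransmission u₁ h))))) ⟩
      E {2 + k} (λ h → ι (Gut (PG u₁ h)) +ᴿ ι 12 *ᴿ ι (rootTransmission u₁ h)) +ᴿ (p₁ *ᴿ ι a +ᴿ p₂ *ᴿ ι b)
        ≈⟨ +-congʳ (≈-trans (E-+ {2 + k} (λ h → ι (Gut (PG u₁ h))) (λ h → ι 12 *ᴿ ι (rootTransmission u₁ h)))
             (+-congˡ (E-* {2 + k} (ι 12) (λ h → ι (rootTransmission u₁ h))))) ⟩
      E {2 + k} (λ h → ι (Gut (PG u₁ h))) +ᴿ ι 12 *ᴿ E {2 + k} (λ h → ι (rootTransmission u₁ h)) +ᴿ (p₁ *ᴿ ι a +ᴿ p₂ *ᴿ ι b)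
        ≈⟨ +-congʳ (+-cong ih (≈-trans (*-congˡ (E-rootTransmission u₁ k)) (average-* 12 (root₁ k) (root₂ k)))) ⟩
      (p₁ *ᴿ ι f +ᴿ p₂ *ᴿ ι g) +ᴿ (p₁ *ᴿ ι (12 * root₁ k) +ᴿ p₂ *ᴿ ι (12 * root₂ k)) +ᴿ (p₁ *ᴿ ι a +ᴿ p₂ *ᴿ ι b)
        ≈⟨ +-congʳ (average-+ f g (12 * root₁ k) (12 * root₂ k)) ⟩
      (p₁ *ᴿ ι (f + 12 * root₁ k) +ᴿ p₂ *ᴿ ι (g + 12 * root₂ k)) +ᴿ (p₁ *ᴿ ι a +ᴿ p₂ *ᴿ ι b)
        ≈⟨ average-+ (f + 12 * root₁ k) (g + 12 * root₂ k) a b ⟩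
      p₁ *ᴿ ι (f + 12 * root₁ k + a) +ᴿ p₂ *ᴿ ι (g + 12 * root₂ k + b) ∎
      where
      a = 1021 + 564 * k
      b = 1165 + 708 * k

    E-Gut : ∀ u₁ k → E {2 + k} (λ h → ι (Gut (PG u₁ h))) ≈ p₁ *ᴿ ι (gut₁ k) +ᴿ p₂ *ᴿ ι (gut₂ k)
    E-Gut u₁ zero = begin
      1# *ᴿ ι (Gut (PG u₁ two)) +ᴿ 0#  ≈⟨ ≈-trans (+ᴿ-identityʳ _) (*-identityˡ _) ⟩
      ι (Gut (PG u₁ two))             ≈⟨ reflexive (cong ι (Gut-two u₁)) ⟩
      ι 529                           ≈⟨ average-constant (ι 529) ⟩
      p₁ *ᴿ ι 529 +ᴿ p₂ *ᴿ ι 529      ∎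
    E-Gut u₁ (suc k) = begin
      E {3 + k} (λ h → ι (Gut (PG u₁ h)))
        ≈⟨ E-Gut-step u₁ k (gut₁ k) (gut₂ k) (E-Gut u₁ k) ⟩
      p₁ *ᴿ ι (gut₁ k + 12 * root₁ k + (1021 + 564 * k)) +ᴿ p₂ *ᴿ ι (gut₂ k + 12 * root₂ k + (1165 + 708 * k))
        ≈⟨ average-≡ (near k) (far k) ⟩
      p₁ *ᴿ ι (gut₁ (suc k)) +ᴿ p₂ *ᴿ ι (gut₂ (suc k)) ∎
      where
      near : ∀ k → 529 + 769 * k + 348 * (k * k) + 48 * (k * k * k) + 12 * (12 + 23 * k + 12 * (k * k)) + (1021 + 564 * k)
        ≡ 529 + 769 * suc k + 348 * (suc k * suc k) + 48 * (suc k * suc k * suc k)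
      near = solve-∀
      far : ∀ k → 529 + 817 * k + 420 * (k * k) + 72 * (k * k * k) + 12 * (12 + 29 * k + 18 * (k * k)) + (1165 + 708 * k)
        ≡ 529 + 817 * suc k + 420 * (suc k * suc k) + 72 * (suc k * suc k * suc k)
      far = solve-∀

    E-Gut-closed : ∀ u₁ n → 1 ≤ℕ n → E {n} (λ h → ι (Gut (PG u₁ h)))
      ≈ (ι 72 -ᴿ ι 24 *ᴿ p₁) *ᴿ ι n ^ᴿ 3
        +ᴿ (ι 72 *ᴿ p₁ -ᴿ ι 12) *ᴿ ι n ^ᴿ 2
        +ᴿ (1# -ᴿ ι 48 *ᴿ p₁) *ᴿ ι n
        -ᴿ 1#
    E-Gut-closed u₁ 1 _ = begin
      1# *ᴿ ι (Gut pentagon) +ᴿ 0#  ≈⟨ ≈-trans (+ᴿ-identityʳ _) (*-identityˡ _) ⟩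
      ι (Gut pentagon)              ≈⟨ reflexive (cong ι Gut-pentagon) ⟩
      ι 60                          ≈⟨ average-constant (ι 60) ⟩
      -- At n = 1 both 48 + 60 - 47 - 1 and 72 - 12 + 1 - 1 equal 60, so the single pentagon fits
      -- the same formula.
      p₁ *ᴿ ι 60 +ᴿ p₂ *ᴿ ι 60      ≈⟨ closed-form p₁+p₂≈1 1 60 60 refl refl ⟩
      _                             ∎
    E-Gut-closed u₁ (suc (suc k)) _ = ≈-trans (E-Gut u₁ k)
      (closed-form p₁+p₂≈1 (2 + k) (gut₁ k) (gut₂ k) (near k) (far k))
      where
      near : ∀ k → 529 + 769 * k + 348 * (k * k) + 48 * (k * k * k) + (47 * (2 + k) + 1)
        ≡ 48 * ((2 + k) * ((2 + k) * (2 + k))) + 60 * ((2 + k) * (2 + k))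
      near = solve-∀
      far : ∀ k → 529 + 817 * k + 420 * (k * k) + 72 * (k * k * k) + (12 * ((2 + k) * (2 + k)) + 1)
        ≡ 72 * ((2 + k) * ((2 + k) * (2 + k))) + (2 + k)
      far = solve-∀

theorem2p1 : ∀ {c ℓ₁ ℓ₂} (R : OrderedCommutativeRing c ℓ₁ ℓ₂) →
    let open OrderedCommutativeRing R in
    (p₁ : Carrier) → 0# ≤ p₁ → p₁ ≤ 1# →
    (law : Law R p₁ (1# -ᴿ p₁)) →
    (u₁ : Fin 5) →
    (n : ℕ) → 1 ≤ℕ n →
    𝔼 R law {n} (λ h → ι (Gut (PG u₁ h)))
    ≈ (ι 72 -ᴿ ι 24 *ᴿ p₁) *ᴿ ι n ^ᴿ 3
    +ᴿ (ι 72 *ᴿ p₁ -ᴿ ι 12) *ᴿ ι n ^ᴿ 2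
    +ᴿ (1# -ᴿ ι 48 *ᴿ p₁) *ᴿ ι n
    -ᴿ 1#
theorem2p1 R p₁ _ _ law u₁ n 1≤n = E-Gut-closed R law p₁+[1-p₁]≈1 u₁ n 1≤n
  where
  open OrderedCommutativeRing R using (_≈_; _+ᴿ_; _-ᴿ_; -_; 1#; ring) renaming (+-assoc to +ᴿ-assoc; sym to ≈-sym; trans to ≈-trans)
  open import Algebra.Properties.Ring ring using (xyx⁻¹≈y)
  p₁+[1-p₁]≈1 : p₁ +ᴿ (1# -ᴿ p₁) ≈ 1#
  p₁+[1-p₁]≈1 = ≈-trans (≈-sym (+ᴿ-assoc p₁ 1# (- p₁))) (xyx⁻¹≈y p₁ 1#)
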